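{- Let $\mathfrak u$ be either an infinite sequence with all terms in $\{0,1\}$, or a finite sequence of length $N\ge1$ with all terms in $\{0,1\}$. Then $\Upsilon(\Upsilon(\mathfrak u))=\mathfrak u$. Consequently $\Upsilon^{(6)}(\mathfrak u)=\mathfrak u$, i.e. all levels of the discrete helicoid generated by $\mathfrak u$ coincide, and its base level consists of three copies (rotated about $a_0$ by multiples of $120^\circ$) of the rhombus formed by the P-G triangle generated by $\mathfrak u$ together with the P-G triangle generated by $\Upsilon(\mathfrak u)$, these two triangles being mirror images of each other across their common edge $\Upsilon(\mathfrak u)$.
   Context: For a finite or infinite sequence $\mathfrak u=(a_0,a_1,\dots)$ of non-negative integers, the P-G triangle generated by $\mathfrak u$ consists of the numbers $d_k^{(j)}$ defined by $d_k^{(0)}=a_k$ and $d_k^{(j+1)}=|d_{k+1}^{(j)}-d_k^{(j)}|$ for $j,k\ge 0$ (for a finite sequence $(a_0,\dots,a_{N-1})$, for $0\le k\le N-1-j$). The operator $\Upsilon$ sends $\mathfrak u$ to the left edge $(d_0^{(0)},d_0^{(1)},d_0^{(2)},\dots)$ of its P-G triangle (a sequence of the same length as $\mathfrak u$); $\Upsilon^{(n)}$ denotes its $n$-th iterate. Geometrically, the P-G triangle of $\Upsilon^{(k+1)}(\mathfrak u)$ is placed rotated by $60^\circ$ clockwise about $a_0$ relative to that of $\Upsilon^{(k)}(\mathfrak u)$, sharing the edge $\Upsilon^{(k+1)}(\mathfrak u)$; the six triangles for $k=0,\dots,5$ form the base level of the helicoid, and level $n+1$ is the base level generated by $\Upsilon^{(6n)}(\mathfrak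 u)$. -}

module Defs where

open import Data.Fin.Base using (Fin; toℕ)
open import Data.Integer.Base as ℤ using (ℤ; +_; -_; _⊖_)
open import Data.Nat.Base using (ℕ; zero; suc; _+_; _*_; _<_; ∣_-_∣)
open import Data.Nat.GeneralisedArithmetic using (fold)
open import Data.Nat.Properties using (<-trans; n<1+n; +-suc; +-identityʳ)
open import Data.Product.Base using (_×_; _,_; Σ-syntax; ∃-syntax)
open import Data.Sum.Base using (_⊎_)
open import Level using (0ℓ)
open import Relation.Binary.Construct.Add.Supremum.Strict _<_ using (_<⁺_; [_]; <⁺-trans)
open import Relation.Binary.PropositionalEquality using (_≡_; subst; sym)
open import Relation.Nullary.Construct.Add.Supremum using (_⁺; [_])
open import Relation.Unary using (Pred; _∪_)

-- A length is [ N ] for a finite sequence (a₀ , … , a_{N-1}) and ⊤⁺ for an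
-- infinite one; the admissible indices are the k with [ k ] <⁺ ℓ.
Length : Set
Length = ℕ ⁺

-- The bound is irrelevant, so a term depends only on its index.
Seq : Length → Set
Seq ℓ = (k : ℕ) → .([ k ] <⁺ ℓ) → ℕ

infix 4 _≋_

_≋_ : ∀ {ℓ} → Seq ℓ → Seq ℓ → Set
_≋_ {ℓ} u v = (k : ℕ) → .(k<ℓ : [ k ] <⁺ ℓ) → u k k<ℓ ≡ v k k<ℓ

Binary : ∀ {ℓ} → Seq ℓ → Set
Binary {ℓ} u = (k : ℕ) → .(k<ℓ : [ k ] <⁺ ℓ) → u k k<ℓ ≡ 0 ⊎ u k k<ℓ ≡ 1

below : ∀ {ℓ} k → [ suc k ] <⁺ ℓ → [ k ] <⁺ ℓ
below k = <⁺-trans <-trans [ n<1+n k ]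

right : ∀ {ℓ} j k → [ suc j + k ] <⁺ ℓ → [ j + suc k ] <⁺ ℓ
right {ℓ} j k = subst (λ i → [ i ] <⁺ ℓ) (sym (+-suc j k))

left : ∀ {ℓ} j → [ j ] <⁺ ℓ → [ j + 0 ] <⁺ ℓ
left {ℓ} j = subst (λ i → [ i ] <⁺ ℓ) (sym (+-identityʳ j))

-- d u j k is d_k^(j): the superscript (row) comes first.
d : ∀ {ℓ} → Seq ℓ → (j k : ℕ) → .([ j + k ] <⁺ ℓ) → ℕ
d u zero    k h = u k h
d u (suc j) k h = ∣ d u j (suc k) (right j k h) - d u j k (below (j + k) h) ∣

Υ : ∀ {ℓ} → Seq ℓ → Seq ℓ
Υ u j h = d u j 0 (left j h)

Υ^ : ∀ {ℓ} → ℕ → Seq ℓ → Seq ℓ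
Υ^ n u = fold u Υ n

-- (x , y) is the point x e + y f of the triangular lattice with a₀ at the
-- origin, where e and f are unit vectors and f is e turned by 60° clockwise.
Point : Set
Point = ℤ × ℤ

-- A set of labelled lattice points: (p , v) belongs to the figure when it
-- carries the number v at p.
Figure : Set₁
Figure = Pred (Point × ℕ) 0ℓ

support : Figure → Pred Point 0ℓ
support F p = ∃[ v ] F (p , v)

image : (Point → Point) → Figure → Figure
image φ F (p , v) = ∃[ q ] p ≡ φ q × F (q , v)

-- Clockwise about a₀: e ↦ f and f ↦ f - e.
rotate60 : Point → Point
rotate60 (x , y) = - y , x ℤ.+ y

rotate : ℕ → Point → Point
rotate n p = fold p rotate60 n

-- The reflection across the line spanned by f: it fixes f and exchanges the
-- unit vectors e and f - e, which make angles of 60° with f on its two sides.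
mirror : Point → Point
mirror (x , y) = - x , x ℤ.+ y

-- Row 0 runs along e and the left edge along f, so that d_k^(j+1) is the third
-- vertex of the small triangle on the side from d_k^(j) to d_{k+1}^(j).
triangle : ∀ {ℓ} → Seq ℓ → Figure
triangle {ℓ} u (p , v) =
  ∃[ j ] ∃[ k ] Σ[ h ∈ [ j + k ] <⁺ ℓ ] (p ≡ (+ k , + j) × v ≡ d u j k h)

leftEdge : ∀ {ℓ} → Seq ℓ → Figure
leftEdge {ℓ} u (p , v) = ∃[ j ] Σ[ h ∈ [ j ] <⁺ ℓ ] (p ≡ (+ 0 , + j) × v ≡ Υ u j h)

baseLevel : ∀ {ℓ} → Seq ℓ → Fin 6 → Figure
baseLevel u k = image (rotate (toℕ k)) (triangle (Υ^ (toℕ k) u))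

-- level u n is level n + 1 of the helicoid, projected to the plane.
level : ∀ {ℓ} → Seq ℓ → ℕ → Fin 6 → Figure
level u n = baseLevel (Υ^ (6 * n) u)

rhombus : ∀ {ℓ} → Seq ℓ → Figure
rhombus u = triangle u ∪ image (rotate 1) (triangle (Υ u))

-- The points s e + t (f - e) with s , t < ℓ: for ℓ = [ N ] a geometric rhombus
-- with N points on each side, for ℓ = ⊤⁺ its unbounded analogue.
rhombusPoints : Length → Pred Point 0ℓ
rhombusPoints ℓ p =
  ∃[ s ] ∃[ t ] [ s ] <⁺ ℓ × [ t ] <⁺ ℓ × p ≡ (s ⊖ t , + t)

{-# OPTIONS --safe #-}
-- Over {0,1} one has ||a - b| - b| = a: the three entries of a small triangle
-- are related symmetrically.  Hence the P-G triangle of Υ u is that of u with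
-- rows and diagonals exchanged, d_k^(j)(Υ u) = d_j^(k)(u).  The case k = 0 is
-- Υ (Υ u) = u, and in the plane this exchange is the reflection across the
-- common edge.
module Submission where

open import Defs
open import Data.Fin.Base using (Fin; toℕ; combine)
open import Data.Fin.Patterns using (0F; 1F; 2F; 3F; 4F; 5F)
open import Data.Integer.Base using (+_; -_)
open import Data.Integer.Properties using (⊖-≥; ⊖-≤)
open import Data.Nat.Base using (ℕ; zero; suc; _+_; _*_; _<_; _≤_; _∸_; ∣_-_∣)
open import Data.Nat.Properties
  using ( ≤-total; ≤-<-trans; +-comm; +-suc; +-identityʳ; *-comm; *-assoc
        ; m≤m+n; m≤n+m; m+n∸m≡n; m+[n∸m]≡n; m∸n+n≡m)
open import Data.Product.Base using (_×_; _,_; proj₁; proj₂)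
open import Data.Sum.Base as Sum using (_⊎_; inj₁; inj₂)
open import Relation.Binary.Construct.Add.Supremum.Strict _<_ using (_<⁺_; [_]; [_]<⊤⁺)
open import Relation.Binary.PropositionalEquality using (_≡_; refl; sym; trans; cong; cong₂; subst)
open import Relation.Nullary.Construct.Add.Supremum using ([_])
open import Relation.Unary using (_∈_; _⊆_; _≐_; _∩_; _∪_; ⋃)
open import Relation.Unary.Properties using (≐-trans)

private
  variable
    ℓ : Length
    u v : Seq ℓ

Bit : ℕ → Set
Bit n = n ≡ 0 ⊎ n ≡ 1

Bit-∣-∣ : ∀ {m n} → Bit m → Bit n → Bit ∣ m - n ∣
Bit-∣-∣ (inj₁ refl) (inj₁ refl) = inj₁ refl
Bit-∣-∣ (inj₁ refl) (inj₂ refl) = inj₂ refl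
Bit-∣-∣ (inj₂ refl) (inj₁ refl) = inj₂ refl
Bit-∣-∣ (inj₂ refl) (inj₂ refl) = inj₁ refl

-- On bits the absolute difference is addition modulo 2, so applying it twice with the same `n`
-- cancels.
∣∣m-n∣-n∣≡m : ∀ {m n} → Bit m → Bit n → ∣ ∣ m - n ∣ - n ∣ ≡ m
∣∣m-n∣-n∣≡m (inj₁ refl) (inj₁ refl) = refl
∣∣m-n∣-n∣≡m (inj₁ refl) (inj₂ refl) = refl
∣∣m-n∣-n∣≡m (inj₂ refl) (inj₁ refl) = refl
∣∣m-n∣-n∣≡m (inj₂ refl) (inj₂ refl) = refl

reindex : ∀ {i j} → i ≡ j → [ i ] <⁺ ℓ → [ j ] <⁺ ℓ
reindex {ℓ} = subst (λ i → [ i ] <⁺ ℓ)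

shrink : ∀ {i j} → i ≤ j → [ j ] <⁺ ℓ → [ i ] <⁺ ℓ
shrink i≤j [ j<n ]   = [ ≤-<-trans i≤j j<n ]
shrink i≤j [ j ]<⊤⁺ = [ _ ]<⊤⁺

≋-trans : {u v w : Seq ℓ} → u ≋ v → v ≋ w → u ≋ w
≋-trans u≋v v≋w k k<ℓ = trans (u≋v k k<ℓ) (v≋w k k<ℓ)

d-cong : u ≋ v → ∀ j k .h → d u j k h ≡ d v j k h
d-cong u≋v zero    k h = u≋v k h
d-cong u≋v (suc j) k h = cong₂ ∣_-_∣ (d-cong u≋v j (suc k) _) (d-cong u≋v j k _)

d-binary : Binary u → ∀ j k .h → Bit (d u j k h)
d-binary bin zero    k h = bin k h
d-binary bin (suc j) k h = Bit-∣-∣ (d-binary bin j (suc k) _) (d-binary bin j k _)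

Υ-cong : u ≋ v → Υ u ≋ Υ v
Υ-cong u≋v j h = d-cong u≋v j 0 _

Υ-binary : Binary u → Binary (Υ u)
Υ-binary bin j h = d-binary bin j 0 _

Υ^-binary : ∀ n → Binary u → Binary (Υ^ n u)
Υ^-binary zero    bin = bin
Υ^-binary (suc n) bin = Υ-binary (Υ^-binary n bin)

-- Induction on the row `j`. The sums `j + k` and `k + j` agree only propositionally, so each side
-- carries its own irrelevant bound.
d-Υ : {u : Seq ℓ} → Binary u → ∀ j k .(h : [ j + k ] <⁺ ℓ) .(h′ : [ k + j ] <⁺ ℓ) →
      d (Υ u) j k h ≡ d u k j h′
d-Υ bin zero    k h h′ = refl
d-Υ bin (suc j) k h h′ = trans
  (cong₂ ∣_-_∣ (d-Υ bin j (suc k) _ (reindex (+-suc k j) h′))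
               (d-Υ bin j k _ (below (k + j) (reindex (+-suc k j) h′))))
  -- The induction hypotheses leave the difference of `d u (suc k) j` and `d u k j`; the former
  -- unfolds to the difference of `d u k (suc j)` and `d u k j`, and the second of these cancels.
  (∣∣m-n∣-n∣≡m (d-binary bin k (suc j) _) (d-binary bin k j _))

Υ-involutive : Binary u → Υ (Υ u) ≋ u
Υ-involutive bin j h = d-Υ bin j 0 _ h

-- With the exponent written `n * 2`, a successor step peels off two applications of `Υ` by
-- computation.
Υ^-even : ∀ n → Binary u → Υ^ (n * 2) u ≋ u
Υ^-even zero    bin k h = refl
Υ^-even (suc n) bin = ≋-trans (Υ-involutive (Υ^-binary (n * 2) bin)) (Υ^-even n bin)

Υ^-6* : ∀ n → Binary u → Υ^ (6 * n) u ≋ u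
Υ^-6* {u = u} n bin =
  subst (λ m → Υ^ m u ≋ u) (trans (*-assoc n 3 2) (*-comm n 6)) (Υ^-even (n * 3) bin)

image-mono : ∀ φ (F G : Figure) → F ⊆ G → image φ F ⊆ image φ G
image-mono φ F G F⊆G (q , p≡φq , q∈F) = q , p≡φq , F⊆G q∈F

image-cong : ∀ φ (F G : Figure) → F ≐ G → image φ F ≐ image φ G
image-cong φ F G (F⊆G , G⊆F) = image-mono φ F G F⊆G , image-mono φ G F G⊆F

image-∪ : ∀ φ (F G : Figure) → image φ F ∪ image φ G ≐ image φ (F ∪ G)
image-∪ φ F G =
  (λ { (inj₁ (q , e , q∈F)) → q , e , inj₁ q∈F
     ; (inj₂ (q , e , q∈G)) → q , e , inj₂ q∈G }) ,
  (λ { (q , e , inj₁ q∈F) → inj₁ (q , e , q∈F)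
     ; (q , e , inj₂ q∈G) → inj₂ (q , e , q∈G) })

-- `fold` adds the new turn on the outside; nesting images needs it on the inside.
rotate-suc : ∀ n p → rotate n (rotate60 p) ≡ rotate (suc n) p
rotate-suc zero    p = refl
rotate-suc (suc n) p = cong rotate60 (rotate-suc n p)

image-rotate-suc : ∀ n F → image (rotate (suc n)) F ≐ image (rotate n) (image (rotate 1) F)
image-rotate-suc n F =
  (λ { (q , refl , q∈F) → rotate 1 q , sym (rotate-suc n q) , q , refl , q∈F }) ,
  (λ { (_ , refl , q , refl , q∈F) → q , rotate-suc n q , q∈F })

triangle-mono : u ≋ v → triangle u ⊆ triangle v
triangle-mono u≋v (j , k , h , p≡ , x≡) = j , k , h , p≡ , trans x≡ (d-cong u≋v j k h)

triangle-cong : u ≋ v → triangle u ≐ triangle v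
triangle-cong u≋v = triangle-mono u≋v , triangle-mono (λ k k<ℓ → sym (u≋v k k<ℓ))

Υ^-cong : ∀ n → u ≋ v → Υ^ n u ≋ Υ^ n v
Υ^-cong zero    u≋v = u≋v
Υ^-cong (suc n) u≋v = Υ-cong (Υ^-cong n u≋v)

baseLevel-cong : u ≋ v → ∀ k → baseLevel u k ≐ baseLevel v k
baseLevel-cong {u = u} {v} u≋v k =
  image-cong (rotate (toℕ k)) (triangle (Υ^ (toℕ k) u)) (triangle (Υ^ (toℕ k) v))
    (triangle-cong (Υ^-cong (toℕ k) u≋v))

∪-cong : {F F′ G G′ : Figure} → F ≐ F′ → G ≐ G′ → F ∪ G ≐ F′ ∪ G′
∪-cong (f , f′) (g , g′) = Sum.map f g , Sum.map f′ g′

-- Meant for `v` an even iterate of `Υ`: the triangles numbered `n` and `suc n` are then the two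
-- halves of the rhombus of `u`, both turned `n` times.
rhombus-copy : ∀ n {u v : Seq ℓ} → v ≋ u →
  image (rotate n) (triangle v) ∪ image (rotate (suc n)) (triangle (Υ v))
    ≐ image (rotate n) (rhombus u)
rhombus-copy n {u} {v} v≋u =
  ≐-trans (∪-cong {Tv} {Tu} (image-cong ρ (triangle v) (triangle u) (triangle-cong v≋u))
                            second)
          (image-∪ ρ (triangle u) Ru)
  where
  ρ = rotate n
  Tu = image ρ (triangle u)
  Tv = image ρ (triangle v)
  Ru = image (rotate 1) (triangle (Υ u))
  Rv = image (rotate 1) (triangle (Υ v))

  second : image (rotate (suc n)) (triangle (Υ v)) ≐ image ρ Ru
  second = ≐-trans (image-rotate-suc n (triangle (Υ v)))
    (image-cong ρ Rv Ru
      (image-cong (rotate 1) (triangle (Υ v)) (triangle (Υ u)) (triangle-cong (Υ-cong v≋u))))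

baseLevel-pair : {u : Seq ℓ} → Binary u → ∀ (m : Fin 3) →
  baseLevel u (combine {3} {2} m 0F) ∪ baseLevel u (combine {3} {2} m 1F)
    ≐ image (rotate (2 * toℕ m)) (rhombus u)
-- The indices `combine m 0F` and `combine m 1F` compute to 2m and 2m + 1, whence the turns 0, 2 and
-- 4.
baseLevel-pair bin 0F = rhombus-copy 0 (Υ^-even 0 bin)
baseLevel-pair bin 1F = rhombus-copy 2 (Υ^-even 1 bin)
baseLevel-pair bin 2F = rhombus-copy 4 (Υ^-even 2 bin)

baseLevel-⋃ : {u : Seq ℓ} → Binary u →
  ⋃ (Fin 6) (baseLevel u) ≐ ⋃ (Fin 3) (λ m → image (rotate (2 * toℕ m)) (rhombus u))
baseLevel-⋃ {u = u} bin =
  (λ { (0F , x∈) → 0F , proj₁ (baseLevel-pair bin 0F) (inj₁ x∈)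
     ; (1F , x∈) → 0F , proj₁ (baseLevel-pair bin 0F) (inj₂ x∈)
     ; (2F , x∈) → 1F , proj₁ (baseLevel-pair bin 1F) (inj₁ x∈)
     ; (3F , x∈) → 1F , proj₁ (baseLevel-pair bin 1F) (inj₂ x∈)
     ; (4F , x∈) → 2F , proj₁ (baseLevel-pair bin 2F) (inj₁ x∈)
     ; (5F , x∈) → 2F , proj₁ (baseLevel-pair bin 2F) (inj₂ x∈) }) ,
  λ (m , x∈) → from m (proj₂ (baseLevel-pair bin m) x∈)
  where
  from : ∀ m → baseLevel u (combine {3} {2} m 0F) ∪ baseLevel u (combine {3} {2} m 1F)
                 ⊆ ⋃ (Fin 6) (baseLevel u)
  from m (inj₁ x∈) = combine {3} {2} m 0F , x∈
  from m (inj₂ x∈) = combine {3} {2} m 1F , x∈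

-- The common edge is the diagonal `s ≡ t`. The triangle of `u` fills `t ≤ s`, with row `t` and
-- position `s ∸ t`; the turned triangle of `Υ u` fills `s ≤ t`, with row `t ∸ s` and position `s`.
-- The sum of row and position is the larger of `s` and `t`, so the bounds match.
rhombus-support : (u : Seq ℓ) → support (rhombus u) ≐ rhombusPoints ℓ
rhombus-support {ℓ} u = to , from
  where
  to : support (rhombus u) ⊆ rhombusPoints ℓ
  to (_ , inj₁ (j , k , h , refl , _)) =
    j + k , j , h , shrink (m≤m+n j k) h ,
    cong (_, + j) (sym (trans (⊖-≥ (m≤m+n j k)) (cong +_ (m+n∸m≡n j k))))
  to (_ , inj₂ (_ , refl , j , k , h , refl , _)) =
    k , k + j , shrink (m≤n+m k j) h , reindex (+-comm j k) h ,
    cong (_, + (k + j)) (sym (trans (⊖-≤ (m≤m+n k j)) (cong (λ i → - + i) (m+n∸m≡n k j))))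

  from : rhombusPoints ℓ ⊆ support (rhombus u)
  from (s , t , s<ℓ , t<ℓ , refl) with ≤-total t s
  ... | inj₁ t≤s = _ , inj₁
    (t , s ∸ t , reindex (sym (m+[n∸m]≡n t≤s)) s<ℓ , cong (_, + t) (⊖-≥ t≤s) , refl)
  ... | inj₂ s≤t = _ , inj₂
    (_ , cong₂ _,_ (⊖-≤ s≤t) (cong +_ (sym (m+[n∸m]≡n s≤t))) ,
     t ∸ s , s , reindex (sym (m∸n+n≡m s≤t)) t<ℓ , refl , refl)

-- The first coordinate is nonnegative on one triangle and nonpositive on the other, so they meet
-- only where it is 0. There the labels agree because row 0 of `Υ u` is the left edge of `u`.
triangles-∩ : {u : Seq ℓ} → Binary u →
  triangle u ∩ image (rotate 1) (triangle (Υ u)) ≐ leftEdge u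
triangles-∩ {u = u} bin = to , from
  where
  to : triangle u ∩ image (rotate 1) (triangle (Υ u)) ⊆ leftEdge u
  to ((j , zero , h , refl , x≡) , _) =
    j , reindex (+-identityʳ j) h , refl , x≡
  -- Splitting on the row in the second triangle lets `- + j` reduce, which exposes the clash with a
  -- positive coordinate.
  to ((_ , suc _ , _ , refl , _) , (_ , () , zero  , _ , _ , refl , _))
  to ((_ , suc _ , _ , refl , _) , (_ , () , suc _ , _ , _ , refl , _))

  from : leftEdge u ⊆ triangle u ∩ image (rotate 1) (triangle (Υ u))
  from (j , h , refl , x≡) =
    (j , 0 , left j h , refl , x≡) ,
    (_ , cong (λ i → + 0 , + i) (sym (+-identityʳ j)) , 0 , j , h , refl , x≡)

-- Turning `(+ k , + j)` and reflecting `(+ j , + k)` give the same point, so the reflection amounts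
-- to the exchange of row and position in `d-Υ`.
triangle-Υ-mirror : {u : Seq ℓ} → Binary u →
  image (rotate 1) (triangle (Υ u)) ≐ image mirror (triangle u)
triangle-Υ-mirror bin =
  (λ { (_ , refl , j , k , h , refl , refl) →
       _ , cong (λ i → - + j , + i) (+-comm k j) ,
       k , j , reindex (+-comm j k) h , refl , d-Υ bin j k h _ }) ,
  (λ { (_ , refl , j , k , h , refl , refl) →
       _ , cong (λ i → - + k , + i) (+-comm k j) ,
       k , j , reindex (+-comm j k) h , refl , sym (d-Υ bin k j _ h) })

theorem2p4 : ∀ ℓ → [ 0 ] <⁺ ℓ → (u : Seq ℓ) → Binary u →
    Υ (Υ u) ≋ u
    × Υ^ 6 u ≋ u
    × (∀ n (k : Fin 6) → level u n k ≐ level u 0 k)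
    × (∀ (m : Fin 3) →
        baseLevel u (combine {3} {2} m 0F) ∪ baseLevel u (combine {3} {2} m 1F)
          ≐ image (rotate (2 * toℕ m)) (rhombus u))
    × ⋃ (Fin 6) (baseLevel u) ≐ ⋃ (Fin 3) (λ m → image (rotate (2 * toℕ m)) (rhombus u))
    × support (rhombus u) ≐ rhombusPoints ℓ
    × triangle u ∩ image (rotate 1) (triangle (Υ u)) ≐ leftEdge u
    × (∀ p v → (p , v) ∈ leftEdge u → mirror p ≡ p)
    × image (rotate 1) (triangle (Υ u)) ≐ image mirror (triangle u)
theorem2p4 ℓ _ u bin =
  Υ-involutive bin ,
  Υ^-6* 1 bin ,
  (λ n → baseLevel-cong (Υ^-6* n bin)) ,
  baseLevel-pair bin ,
  baseLevel-⋃ bin ,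
  rhombus-support u ,
  triangles-∩ bin ,
  (λ { p v (j , h , refl , _) → refl }) ,
  triangle-Υ-mirror bin
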